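{- Suppose $|\mathsf{Ag}|\ge2$. Let $\mathcal L,\mathcal L'$ range over the eight languages $\mathcal{EL},\mathcal{ELC},\mathcal{ELD},\mathcal{ELM},\mathcal{ELCD},\mathcal{ELCM},\mathcal{ELDM},\mathcal{ELCDM}$. Then, both when equivalence of formulas is taken over the class of all models and when it is taken over the class of all similarity models: (1) for any superlanguage $\mathcal L$ of $\mathcal{ELC}$ and any sublanguage $\mathcal L'$ of $\mathcal{ELDM}$, it is not the case that $\mathcal L\preceq\mathcal L'$; (2) for any superlanguage $\mathcal L$ of $\mathcal{ELD}$ and any sublanguage $\mathcal L'$ of $\mathcal{ELCM}$, it is not the case that $\mathcal L\preceq\mathcal L'$; (3) for any superlanguage $\mathcal L$ of $\mathcal{ELM}$ and any sublanguage $\mathcal L'$ of $\mathcal{ELCD}$, it is not the case that $\mathcal L\preceq\mathcal L'$.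
   Context: Languages. Fix a countably infinite set $\mathsf{Prop}$ of propositional variables and a finite nonempty set $\mathsf{Ag}$ of agents. A group is a nonempty subset $G\subseteq\mathsf{Ag}$. The formulas of $\mathcal{EL}$ are given by $\varphi::=p\mid\neg\varphi\mid(\varphi\to\varphi)\mid K_a\varphi$ with $p\in\mathsf{Prop}$, $a\in\mathsf{Ag}$. For a subset $X$ of $\{C,D,M\}$, the language $\mathcal{ELX}$ adds to this grammar the clause $C_G\varphi$ if $C\in X$, the clause $D_G\varphi$ if $D\in X$, and the clause $M_G\varphi$ if $M\in X$ ($G$ ranging over groups); this gives the eight languages. $\mathcal L$ is a sublanguage of $\mathcal L'$ (and $\mathcal L'$ a superlanguage of $\mathcal L$) if every formula of $\mathcal L$ is a formula of $\mathcal L'$. Other Boolean connectives are abbreviations, and $E_G\varphi:=\bigwedge_{a\in G}K_a\varphi$, $E_G^1\varphi:=E_G\varphi$, $E_G^{n}\varphi:=E_GE_G^{n-1}\varphi$. Models. A model is a tuple $M=(W,A,E,C,\nu)$ with $W$ a nonempty set, $A$ an arbitrary set (possibly empty), $E:W\times W\to\wp(A)$, $C:\mathsf{Ag}\to\wp(A)$, $\nu:W\to\wp(\mathsf{Prop})$. It is a similarity model if for all $s,t\in W$: $E(s,t)=A$ implies $s=t$, and $E(s,t)=E(t,s)$. Semantics. $M,s\models p$ iff $p\in\nu(s)$; $\neg,\to$ as usual; $M,s\models K_a\psi$ iff for all $t\in W$, $C(a)\subseteq E(s,t)$ implies $M,t\models\psi$; $M,s\models C_G\psi$ iff $M,s\models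 E_G^n\psi$ for all integers $n\ge1$; $M,s\models D_G\psi$ iff for all $t\in W$, $\bigcup_{a\in G}C(a)\subseteq E(s,t)$ implies $M,t\models\psi$; $M,s\models M_G\psi$ iff for all $t\in W$, $\bigcap_{a\in G}C(a)\subseteq E(s,t)$ implies $M,t\models\psi$. Expressivity. Two formulas are equivalent over a class of models if they are true at exactly the same states of the same models of the class. $\mathcal L_1\preceq\mathcal L_2$ means that for every $\mathcal L_1$-formula there is an equivalent $\mathcal L_2$-formula. -}

module Defs where

open import Level using (Level; 0ℓ)
open import Data.Bool using (Bool; true; false; T)
open import Data.Fin using (Fin)
open import Data.Fin.Subset using (Subset; Nonempty) renaming (_∈_ to _∈ₛ_)
open import Data.Fin.Subset.Properties using (_∈?_)
open import Data.List using (List; []; _∷_; foldr; filter; allFin)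
open import Data.Nat using (ℕ; zero; suc; _≤_)
open import Data.Product using (∃; ∃-syntax; _×_; proj₁)
open import Function using (_∘_; _⇔_; mk⇔)
open import Relation.Binary.PropositionalEquality using (_≡_; refl; sym; cong; subst)
open import Relation.Unary using (Pred; _∈_; _⊆_; _≐_; _⇒_; ∁; U; ⋃; ⋂)

record Language : Set where
  constructor language
  field
    hasC hasD hasM : Bool

EL ELC ELD ELM ELCD ELCM ELDM ELCDM : Language
EL    = language false false false
ELC   = language true  false false
ELD   = language false true  false
ELM   = language false false true
ELCD  = language true  true  false
ELCM  = language true  false true
ELDM  = language false true  true
ELCDM = language true  true  true

-- The set of agents is Fin n and the set of propositional variables is ℕ.
module Logic (n : ℕ) where

  Agent : Set
  Agent = Fin n

  PropVar : Set
  PropVar = ℕ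

  record Group : Set where
    constructor group
    field
      members  : Subset n
      nonempty : Nonempty members

    Member : Set
    Member = ∃ (_∈ₛ members)

    memberList : List Agent
    memberList = filter (_∈? members) (allFin n)

  open Group public using (members; Member; memberList)

  infixr 5 _⟶_
  infix  7 ∼_ K[_]_ C[_]_ D[_]_ M[_]_

  data Formula : Set where
    var   : PropVar → Formula
    ∼_    : Formula → Formula
    _⟶_   : Formula → Formula → Formula
    K[_]_ : Agent → Formula → Formula
    C[_]_ : Group → Formula → Formula
    D[_]_ : Group → Formula → Formula
    M[_]_ : Group → Formula → Formula

  data _FormulaOf_ : Formula → Language → Set where
    var   : ∀ {L} p → var p FormulaOf L
    ∼_    : ∀ {L φ} → φ FormulaOf L → (∼ φ) FormulaOf L
    _⟶_   : ∀ {L φ ψ} → φ FormulaOf L → ψ FormulaOf L → (φ ⟶ ψ) FormulaOf L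
    K[_]_ : ∀ {L φ} a → φ FormulaOf L → (K[ a ] φ) FormulaOf L
    C     : ∀ {L φ} → T (Language.hasC L) → ∀ G → φ FormulaOf L → (C[ G ] φ) FormulaOf L
    D     : ∀ {L φ} → T (Language.hasD L) → ∀ G → φ FormulaOf L → (D[ G ] φ) FormulaOf L
    M     : ∀ {L φ} → T (Language.hasM L) → ∀ G → φ FormulaOf L → (M[ G ] φ) FormulaOf L

  infix 4 _⊑_
  _⊑_ : Language → Language → Set
  L ⊑ L′ = ∀ φ → φ FormulaOf L → φ FormulaOf L′

  -- The abbreviations ⊤, ∧, E_G and E_G^k are defined once, over any
  -- interpretation of the EL connectives: at Formula they are the syntactic
  -- abbreviations, at predicates on states they are the truth sets of these
  -- (see ⟦everyone^⟧).  This lets truth be defined by structural recursion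
  -- although E_G^k φ is not a subformula of C_G φ.
  record Connectives {ℓ : Level} (F : Set ℓ) : Set ℓ where
    field
      `var : PropVar → F
      `¬   : F → F
      `→   : F → F → F
      `K   : Agent → F → F

    `⊤ : F
    `⊤ = `→ (`var 0) (`var 0)

    `∧ : F → F → F
    `∧ φ ψ = `¬ (`→ φ (`¬ ψ))

    everyone : Group → F → F
    everyone G φ = foldr (λ a χ → `∧ (`K a φ) χ) `⊤ (memberList G)

    everyone^ : Group → ℕ → F → F
    everyone^ G zero    φ = φ
    everyone^ G (suc k) φ = everyone G (everyone^ G k φ)

  syntactic : Connectives Formula
  syntactic = record { `var = var ; `¬ = ∼_ ; `→ = _⟶_ ; `K = K[_]_ }

  record Model : Set₁ where
    field
      W         : Set
      inhabited : W
      A         : Set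
      E         : W → W → Pred A 0ℓ
      Cap       : Agent → Pred A 0ℓ
      ν         : W → Pred PropVar 0ℓ

  record IsSimilarity (𝓜 : Model) : Set where
    open Model 𝓜
    field
      separated : ∀ s t → E s t ≐ U → s ≡ t
      symmetric : ∀ s t → E s t ≐ E t s

  module Semantics (𝓜 : Model) where
    open Model 𝓜

    semantic : Connectives (Pred W 0ℓ)
    semantic = record
      { `var = λ p s → p ∈ ν s
      ; `¬   = ∁
      ; `→   = _⇒_
      ; `K   = λ a P s → ∀ t → Cap a ⊆ E s t → t ∈ P
      }

    open Connectives semantic

    ⟦_⟧ : Formula → Pred W 0ℓ
    ⟦ var p ⟧    = `var p
    ⟦ ∼ φ ⟧      = `¬ ⟦ φ ⟧
    ⟦ φ ⟶ ψ ⟧    = `→ ⟦ φ ⟧ ⟦ ψ ⟧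
    ⟦ K[ a ] φ ⟧ = `K a ⟦ φ ⟧
    ⟦ C[ G ] φ ⟧ = λ s → ∀ k → 1 ≤ k → s ∈ everyone^ G k ⟦ φ ⟧
    ⟦ D[ G ] φ ⟧ = λ s → ∀ t → ⋃ (Member G) (Cap ∘ proj₁) ⊆ E s t → t ∈ ⟦ φ ⟧
    ⟦ M[ G ] φ ⟧ = λ s → ∀ t → ⋂ (Member G) (Cap ∘ proj₁) ⊆ E s t → t ∈ ⟦ φ ⟧

  infix 3 _⟨_⟩⊨_
  _⟨_⟩⊨_ : (𝓜 : Model) → Model.W 𝓜 → Formula → Set
  𝓜 ⟨ s ⟩⊨ φ = s ∈ Semantics.⟦_⟧ 𝓜 φ

  module _ (𝓜 : Model) where
    open Semantics 𝓜
    private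
      module Syn = Connectives syntactic
      module Sem = Connectives semantic

    ⟦everyone⟧ : ∀ G φ → ⟦ Syn.everyone G φ ⟧ ≡ Sem.everyone G ⟦ φ ⟧
    ⟦everyone⟧ G φ = go (memberList G)
      where
      go : ∀ as → ⟦ foldr (λ a χ → Syn.`∧ (K[ a ] φ) χ) Syn.`⊤ as ⟧
                ≡ foldr (λ a χ → Sem.`∧ (Sem.`K a ⟦ φ ⟧) χ) Sem.`⊤ as
      go []       = refl
      go (a ∷ as) = cong (Sem.`∧ (Sem.`K a ⟦ φ ⟧)) (go as)

    ⟦everyone^⟧ : ∀ G k φ → ⟦ Syn.everyone^ G k φ ⟧ ≡ Sem.everyone^ G k ⟦ φ ⟧
    ⟦everyone^⟧ G zero    φ = refl
    ⟦everyone^⟧ G (suc k) φ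
      rewrite ⟦everyone⟧ G (Syn.everyone^ G k φ) | ⟦everyone^⟧ G k φ = refl

    ⊨C⇔ : ∀ s G φ →
      (𝓜 ⟨ s ⟩⊨ C[ G ] φ) ⇔ (∀ k → 1 ≤ k → 𝓜 ⟨ s ⟩⊨ Syn.everyone^ G k φ)
    ⊨C⇔ s G φ = mk⇔
      (λ h k 1≤k → subst (s ∈_) (sym (⟦everyone^⟧ G k φ)) (h k 1≤k))
      (λ h k 1≤k → subst (s ∈_) (⟦everyone^⟧ G k φ) (h k 1≤k))

  Equivalent : Pred Model 0ℓ → Formula → Formula → Set₁
  Equivalent 𝒞 φ ψ = ∀ 𝓜 → 𝓜 ∈ 𝒞 → ∀ s → (𝓜 ⟨ s ⟩⊨ φ) ⇔ (𝓜 ⟨ s ⟩⊨ ψ)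

  infix 4 _≼[_]_
  _≼[_]_ : Language → Pred Model 0ℓ → Language → Set₁
  L₁ ≼[ 𝒞 ] L₂ = ∀ φ → φ FormulaOf L₁ → ∃[ ψ ] ψ FormulaOf L₂ × Equivalent 𝒞 φ ψ

  AllModels SimilarityModels : Pred Model 0ℓ
  AllModels        = U
  SimilarityModels = IsSimilarity

{-# OPTIONS --safe #-}
-- All separating models are similarity models, so they settle both classes.
-- (1) On the chain ℕ, where every modality but C_G steps to a neighbour, a
--     formula of depth k does not see from 0 whether p fails beyond k, but
--     C_G p does.
-- (2) If p is false everywhere and all K_a and M_G are serial, a C, M-formula
--     has the same truth value at all states of all such models, whereas
--     D_G p depends on whether the D_G-relation is empty.
-- (3) If p is false everywhere and no K_a-edge exists, a C, D-formula has the
--     same truth value in all such models, whereas M_G p depends on whether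
--     the capabilities of the agents in G intersect.
module Submission where

open import Defs
open import Level using (0ℓ)
open import Data.Bool using (Bool; true; false; not; T; _∨_; _xor_)
open import Data.Bool.Properties using (xor-comm; xor-assoc; xor-same)
open import Data.Empty using (⊥-elim)
open import Data.Fin using (zero; suc)
open import Data.Fin.Subset as Subset using () renaming (_∈_ to _∈ₛ_)
open import Data.Fin.Subset.Properties using (_∈?_; ∈⊤)
open import Data.List using ([]; _∷_; foldr; allFin)
open import Data.List.Membership.Propositional using () renaming (_∈_ to _∈ₗ_)
open import Data.List.Membership.Propositional.Properties using (∈-filter⁺; ∈-filter⁻; ∈-allFin)
open import Data.List.Relation.Unary.Any using (here; there)
open import Data.Nat using (ℕ; zero; suc; _≤_; z≤n; s≤s; _+_; _⊔_)
open import Data.Nat.Properties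
  using (≤-refl; ≤-reflexive; ≤-trans; n≤1+n; +-suc; +-identityʳ; +-monoʳ-≤;
         m≤m⊔n; m≤n⊔m; m+n≤o⇒m≤o; 1+n≰n)
open import Data.Product using (_×_; _,_; ∃; ∃-syntax; proj₁; proj₂)
open import Data.Sum using (_⊎_; inj₁; inj₂; swap)
open import Data.Unit using (⊤; tt)
open import Function using (_∘_; id; const; case_of_; _⇔_; mk⇔; Equivalence)
open import Function.Related.TypeIsomorphisms using (→-cong-⇔; ¬-cong-⇔)
open import Relation.Binary.PropositionalEquality using (_≡_; refl; sym; trans; cong; subst)
open import Relation.Nullary using (¬_; Reflects; ofʸ; ofⁿ; invert)
open import Relation.Nullary.Reflects using (_→-reflects_; ¬-reflects)
open import Relation.Unary using (Pred; _∈_; _⊆_; U; ∅; ⋃; ⋂)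

-- Box operators and constant truth values.

Box : {W : Set} → (W → W → Set) → Pred W 0ℓ → Pred W 0ℓ
Box R P s = ∀ t → R s t → t ∈ P

box-cong : ∀ {W : Set} {R : W → W → Set} {P Q : Pred W 0ℓ} {s} →
  (∀ t → R s t → P t ⇔ Q t) → Box R P s ⇔ Box R Q s
box-cong h = mk⇔ (λ □P t r → Equivalence.to (h t r) (□P t r))
                 (λ □Q t r → Equivalence.from (h t r) (□Q t r))

-- Recording the common truth value as a Boolean lets the connectives act on it by computation and
-- keeps the argument constructive.
ConstantlyReflects : {W : Set} → Pred W 0ℓ → Bool → Set
ConstantlyReflects P b = ∀ s → Reflects (s ∈ P) b

ActsBy : {W : Set} → (Bool → Bool) → (Pred W 0ℓ → Pred W 0ℓ) → Set₁
ActsBy f □ = ∀ {P} b → ConstantlyReflects P b → ConstantlyReflects (□ P) (f b)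

box-serial : {W : Set} {R : W → W → Set} → (∀ s → ∃ (R s)) → ActsBy id (Box R)
box-serial serial true  c s = ofʸ (λ t _ → invert (c t))
box-serial serial false c s =
  ofⁿ (λ □P → let t , r = serial s in invert (c t) (□P t r))

box-empty : {W : Set} {R : W → W → Set} → (∀ s t → ¬ R s t) → ActsBy (const true) (Box R)
box-empty empty b c s = ofʸ (λ t r → ⊥-elim (empty s t r))

reflects-transfer : ∀ {A B : Set} {b} → Reflects A b → Reflects B b → A → B
reflects-transfer (ofʸ _)  (ofʸ y) _ = y
reflects-transfer (ofⁿ ¬x) _       x = ⊥-elim (¬x x)

∀≥1-reflects : ∀ {P : ℕ → Set} {b} →
  (∀ k → Reflects (P (suc k)) b) → Reflects (∀ k → 1 ≤ k → P k) b
∀≥1-reflects {b = true}  r = ofʸ (λ where (suc k) _ → invert (r k))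
∀≥1-reflects {b = false} r = ofⁿ (λ h → invert (r 0) (h 1 (s≤s z≤n)))

Adjacent : ℕ → ℕ → Set
Adjacent s t = t ≡ suc s ⊎ s ≡ suc t

-- A step raises the state by at most one, and the modality it crosses uses up one unit of depth, so
-- the bound `k` persists.
adjacent-+-≤ : ∀ {s t d k} → Adjacent s t → s + suc d ≤ k → t + d ≤ k
adjacent-+-≤ {s} {d = d} (inj₁ refl) h = ≤-trans (≤-reflexive (sym (+-suc s d))) h
adjacent-+-≤ {t = t} {d} (inj₂ refl) h =
  ≤-trans (≤-trans (+-monoʳ-≤ t (n≤1+n d)) (n≤1+n _)) h

module _ {n : ℕ} where
  open Logic n

  -- Conjunctions over a group.

  ∈-memberList⁺ : ∀ G {a} → a ∈ₛ members G → a ∈ₗ memberList G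
  ∈-memberList⁺ G a∈G = ∈-filter⁺ (_∈? members G) (∈-allFin _) a∈G

  ∈-memberList⁻ : ∀ G {a} → a ∈ₗ memberList G → a ∈ₛ members G
  ∈-memberList⁻ G a∈l = proj₂ (∈-filter⁻ (_∈? members G) {xs = allFin n} a∈l)

  module _ (𝓜 : Model) where
    open Model 𝓜
    open Connectives (Semantics.semantic 𝓜)

    everyone-intro : ∀ G {P s} → (∀ a → a ∈ₛ members G → s ∈ `K a P) → s ∈ everyone G P
    everyone-intro G {P} {s} h = go (memberList G) (λ a → h a ∘ ∈-memberList⁻ G)
      where
      go : ∀ as → (∀ a → a ∈ₗ as → s ∈ `K a P) → s ∈ foldr (λ a χ → `∧ (`K a P) χ) `⊤ as
      go []       _ = id
      go (a ∷ as) h = λ k → k (h a (here refl)) (go as (λ b → h b ∘ there))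

    -- Conjunction is coded by negation and implication, so constructively a conjunct comes out only
    -- doubly negated. Each use has absurdity as its goal.
    everyone-elim : ∀ G {P s a} → a ∈ₛ members G → s ∈ everyone G P → ¬ ¬ (s ∈ `K a P)
    everyone-elim G {P} {s} a∈G = go (memberList G) (∈-memberList⁺ G a∈G)
      where
      go : ∀ {a} as → a ∈ₗ as → s ∈ foldr (λ a χ → `∧ (`K a P) χ) `⊤ as → ¬ ¬ (s ∈ `K a P)
      go (a ∷ as) (here refl) h ¬k = h (λ k _ → ¬k k)
      go (a ∷ as) (there a∈as) h ¬k = h (λ _ rest → go as a∈as rest ¬k)

  -- The two models may depend on `ψ`. An equivalent `ψ` would carry the truth of `φ` from `s` to
  -- `s′`.
  inexpressible : ∀ {L L′ 𝒞} φ → SimilarityModels ⊆ 𝒞 → φ FormulaOf L →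
    (∀ ψ → ψ FormulaOf L′ → ∃[ 𝓜 ] ∃[ s ] ∃[ 𝓜′ ] ∃[ s′ ]
       IsSimilarity 𝓜 × IsSimilarity 𝓜′ ×
       (𝓜 ⟨ s ⟩⊨ φ) × ¬ (𝓜′ ⟨ s′ ⟩⊨ φ) × (𝓜 ⟨ s ⟩⊨ ψ → 𝓜′ ⟨ s′ ⟩⊨ ψ)) →
    ¬ (L ≼[ 𝒞 ] L′)
  inexpressible φ sim⊆𝒞 φ∈L separate L≼L′ with L≼L′ φ φ∈L
  ... | ψ , ψ∈L′ , φ⇔ψ with separate ψ ψ∈L′
  ...   | 𝓜 , s , 𝓜′ , s′ , sim , sim′ , s⊨φ , s′⊭φ , transfer =
    s′⊭φ (Equivalence.from (φ⇔ψ 𝓜′ (sim⊆𝒞 sim′) s′)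
           (transfer (Equivalence.to (φ⇔ψ 𝓜 (sim⊆𝒞 sim) s) s⊨φ)))

  Capable : (𝓜 : Model) → let open Model 𝓜 in Pred A 0ℓ → W → W → Set
  Capable 𝓜 X s t = X ⊆ Model.E 𝓜 s t

  union intersection : (𝓜 : Model) → Group → Pred (Model.A 𝓜) 0ℓ
  union        𝓜 G = ⋃ (Member G) (Model.Cap 𝓜 ∘ proj₁)
  intersection 𝓜 G = ⋂ (Member G) (Model.Cap 𝓜 ∘ proj₁)

  -- f is the common action of the modalities on constant truth values: id when
  -- all are serial, const true when all their relations are empty.
  module _ (f : Bool → Bool) where

    value : Formula → Bool
    value (var _)    = false
    value (∼ φ)      = not (value φ)
    value (φ ⟶ ψ)    = not (value φ) ∨ value ψ
    value (K[ _ ] φ) = f (value φ)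
    value (C[ _ ] φ) = f (value φ)
    value (D[ _ ] φ) = f (value φ)
    value (M[ _ ] φ) = f (value φ)

    module _ (f-idem : ∀ b → f (f b) ≡ f b) (𝓜 : Model)
             (K-acts : ∀ a → ActsBy f (Box (Capable 𝓜 (Model.Cap 𝓜 a)))) where
      open Model 𝓜
      open Semantics 𝓜
      open Connectives semantic

      everyone-acts : ∀ G → ActsBy f (everyone G)
      everyone-acts G {P} b c s with f b | (λ a → K-acts a {P} b c)
      ... | true  | k = ofʸ (everyone-intro 𝓜 G (λ a _ → invert (k a s)))
      -- Nonemptiness of `G` supplies a conjunct that fails.
      ... | false | k = ofⁿ (λ e → let a , a∈G = Group.nonempty G in
                                   everyone-elim 𝓜 G a∈G e (invert (k a s)))

      -- Iterating `everyone` iterates `f`, and idempotence collapses this to one application; hence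
      -- all conjuncts of `C[ G ]` share one value.
      everyone^-acts : ∀ G k → ActsBy f (everyone^ G (suc k))
      everyone^-acts G zero    b c = everyone-acts G b c
      everyone^-acts G (suc k) b c s =
        subst (Reflects _) (f-idem b)
          (everyone-acts G (f b) (everyone^-acts G k b c) s)

      -- `value` looks only at `f` and the formula, so any two models meeting these conditions
      -- agree. The guards `T` restrict the conditions on D and M to languages having those
      -- operators.
      reflects-value : ∀ {L} → (∀ s p → ¬ (p ∈ ν s)) →
        (T (Language.hasD L) → ∀ G → ActsBy f (Box (Capable 𝓜 (union 𝓜 G)))) →
        (T (Language.hasM L) → ∀ G → ActsBy f (Box (Capable 𝓜 (intersection 𝓜 G)))) →
        ∀ {φ} → φ FormulaOf L → ConstantlyReflects ⟦ φ ⟧ (value φ)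
      reflects-value {L} ν-empty D-acts M-acts = go
        where
        go : ∀ {φ} → φ FormulaOf L → ConstantlyReflects ⟦ φ ⟧ (value φ)
        go (var p)    s = ofⁿ (ν-empty s p)
        go (∼ φ)      s = ¬-reflects (go φ s)
        go (φ ⟶ ψ)    s = go φ s →-reflects go ψ s
        go (K[ a ] φ) s = K-acts a _ (go φ) s
        go (C _ G φ)  s = ∀≥1-reflects (λ k → everyone^-acts G k _ (go φ) s)
        go (D d G φ)  s = D-acts d G _ (go φ) s
        go (M m G φ)  s = M-acts m G _ (go φ) s

  point : {A : Set} → (Agent → Pred A 0ℓ) → Pred A 0ℓ → Model
  point {A} cap e = record
    { W = ⊤ ; inhabited = tt ; A = A ; E = λ _ _ → e ; Cap = cap ; ν = λ _ → ∅ }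

  -- A single state makes separation trivial, so `e` may even be `U`.
  point-similarity : ∀ {A} cap e → IsSimilarity (point {A} cap e)
  point-similarity _ _ = record
    { separated = λ _ _ _ → refl ; symmetric = λ _ _ → id , id }

  -- The label false occurs in no E s t, so separation holds vacuously.
  chain : Pred ℕ 0ℓ → Model
  chain V = record
    { W = ℕ ; inhabited = 0 ; A = Bool
    ; E = λ s t x → T x × Adjacent s t
    ; Cap = λ _ → T ; ν = λ s _ → V s }

  chain-similarity : ∀ V → IsSimilarity (chain V)
  chain-similarity V = record
    { separated = λ s t E≐U → ⊥-elim (proj₁ (proj₂ E≐U {false} tt))
    ; symmetric = λ s t → (λ (x , adj) → x , swap adj) , (λ (x , adj) → x , swap adj)
    }

  -- Modal depth and locality on the chain.

  depth : Formula → ℕ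
  depth (var _)    = 0
  depth (∼ φ)      = depth φ
  depth (φ ⟶ ψ)    = depth φ ⊔ depth ψ
  depth (K[ _ ] φ) = suc (depth φ)
  depth (C[ _ ] φ) = suc (depth φ)
  depth (D[ _ ] φ) = suc (depth φ)
  depth (M[ _ ] φ) = suc (depth φ)

  module _ {V V′ : Pred ℕ 0ℓ} {k : ℕ} (V⇔V′ : ∀ s → s ≤ k → V s ⇔ V′ s) where

    -- The label `true` lies in every capability, hence in every union and intersection over a
    -- group, so each of these modalities moves only to neighbours.
    chain-local : ∀ {φ} → φ FormulaOf ELDM → ∀ s → s + depth φ ≤ k →
      (chain V ⟨ s ⟩⊨ φ) ⇔ (chain V′ ⟨ s ⟩⊨ φ)
    chain-local (var p) s h = V⇔V′ s (m+n≤o⇒m≤o s h)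
    chain-local (∼ φ) s h = ¬-cong-⇔ (chain-local φ s h)
    chain-local (_⟶_ {φ = φ₁} {φ₂} φ ψ) s h = →-cong-⇔
      (chain-local φ s (≤-trans (+-monoʳ-≤ s (m≤m⊔n (depth φ₁) _)) h))
      (chain-local ψ s (≤-trans (+-monoʳ-≤ s (m≤n⊔m (depth φ₁) _)) h))
    chain-local (K[ a ] φ) s h =
      box-cong {R = Capable (chain V) T} (λ t r → chain-local φ t
        (adjacent-+-≤ (proj₂ (r {true} tt)) h))
    chain-local (D _ G φ) s h =
      box-cong {R = Capable (chain V) (union (chain V) G)} (λ t r → chain-local φ t
        (adjacent-+-≤ (proj₂ (r {true} (Group.nonempty G , tt))) h))
    chain-local (M _ G φ) s h =
      box-cong {R = Capable (chain V) (intersection (chain V) G)} (λ t r → chain-local φ t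
        (adjacent-+-≤ (proj₂ (r {true} (λ _ → tt))) h))

  chain-everyone^-U : ∀ G k {s} →
    s ∈ Connectives.everyone^ (Semantics.semantic (chain U)) G k U
  chain-everyone^-U G zero    = tt
  chain-everyone^-U G (suc k) =
    everyone-intro (chain U) G (λ _ _ _ _ → chain-everyone^-U G k)

  -- The path that always steps upwards leads from `s` to `s + k`.
  chain-everyone^-reaches : ∀ V G k {s} →
    s ∈ Connectives.everyone^ (Semantics.semantic (chain V)) G k V → ¬ ¬ V (s + k)
  chain-everyone^-reaches V G zero    {s} v ¬v = ¬v (subst V (sym (+-identityʳ s)) v)
  chain-everyone^-reaches V G (suc k) {s} e ¬v =
    everyone-elim (chain V) G (proj₂ (Group.nonempty G)) e λ □ →
      chain-everyone^-reaches V G k (□ (suc s) (λ x → x , inj₁ refl))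
        (¬v ∘ subst V (sym (+-suc s k)))

-- The three separations, with at least two agents.

module _ {m : ℕ} where
  open Logic (suc (suc m))

  everybody : Group
  everybody = group Subset.⊤ (zero , ∈⊤)

  colour : Agent → Bool
  colour zero    = false
  colour (suc _) = true

  colourCap : Agent → Pred Bool 0ℓ
  colourCap a = _≡ colour a

  -- Every pair of states has a singleton label, so K-relations of agents of
  -- different colours are disjoint while each of them stays serial.
  xorModel : Model
  xorModel = record
    { W = Bool ; inhabited = false ; A = Bool
    ; E = λ s t → _≡ s xor t ; Cap = colourCap ; ν = λ _ → ∅ }

  xorModel-similarity : IsSimilarity xorModel
  xorModel-similarity = record
    { separated = λ s t E≐U →
        case trans (proj₂ E≐U {true} tt) (sym (proj₂ E≐U {false} tt)) of λ ()
    ; symmetric = λ s t →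
        (λ e → trans e (xor-comm s t)) , (λ e → trans e (xor-comm t s))
    }

  xor-cancel : ∀ s b → s xor (s xor b) ≡ b
  xor-cancel s b = trans (sym (xor-assoc s s b)) (cong (_xor b) (xor-same s))

  C-inexpressible : ∀ {L L′ 𝒞} → SimilarityModels ⊆ 𝒞 → ELC ⊑ L → L′ ⊑ ELDM →
    ¬ (L ≼[ 𝒞 ] L′)
  C-inexpressible sim⊆𝒞 ELC⊑L L′⊑ELDM =
    inexpressible (C[ everybody ] var 0) sim⊆𝒞 (ELC⊑L _ (C tt everybody (var 0)))
      λ ψ ψ∈L′ → let k = depth ψ in
        -- The valuations agree up to `k`, exactly as far as `ψ` sees from 0.
        chain U , 0 , chain (_≤ k) , 0
      , chain-similarity U , chain-similarity (_≤ k)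
      , (λ j _ → chain-everyone^-U everybody j)
      -- The iterate `suc k` is the first to reach a state where the variable fails.
      , (λ h → chain-everyone^-reaches (_≤ k) everybody (suc k) (h (suc k) (s≤s z≤n)) 1+n≰n)
      , Equivalence.to (chain-local (λ s s≤k → mk⇔ (λ _ → s≤k) _) (L′⊑ELDM ψ ψ∈L′) 0 ≤-refl)

  D-inexpressible : ∀ {L L′ 𝒞} → SimilarityModels ⊆ 𝒞 → ELD ⊑ L → L′ ⊑ ELCM →
    ¬ (L ≼[ 𝒞 ] L′)
  D-inexpressible sim⊆𝒞 ELD⊑L L′⊑ELCM =
    inexpressible (D[ everybody ] var 0) sim⊆𝒞 (ELD⊑L _ (D tt everybody (var 0)))
      λ ψ ψ∈L′ →
        -- The union for `everybody` has both labels: no singleton contains it, so the D-formula is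
        -- vacuous in `xorModel`, whereas at the point with all labels the state sees itself.
        xorModel , false , point colourCap U , tt
      , xorModel-similarity , point-similarity colourCap U
      , (λ t r → case trans (r (((zero , ∈⊤) , refl)))
                   (sym (r ((suc zero , ∈⊤) , refl))) of λ ())
      , (λ h → h tt _)
      , reflects-transfer
          (reflects-value id (λ _ → refl) xorModel
            (λ a → box-serial (xor-serial a)) (λ _ _ ()) (λ ())
            (λ _ G → box-serial (xor-serial-⋂ G))
            (L′⊑ELCM ψ ψ∈L′) false)
          (reflects-value id (λ _ → refl) (point colourCap U)
            (λ a → box-serial λ _ → tt , _) (λ _ _ ()) (λ ())
            (λ _ G → box-serial λ _ → tt , _)
            (L′⊑ELCM ψ ψ∈L′) tt)
    where
    xor-serial : ∀ a s → ∃ (Capable xorModel (colourCap a) s)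
    xor-serial a s = s xor colour a , λ e → trans e (sym (xor-cancel s (colour a)))

    -- The intersection lies within any member's capability, so that member's successor serves here
    -- too.
    xor-serial-⋂ : ∀ G s → ∃ (Capable xorModel (intersection xorModel G) s)
    xor-serial-⋂ G s with Group.nonempty G
    ... | a , a∈G = s xor colour a , λ x → proj₂ (xor-serial a s) (x (a , a∈G))

  M-inexpressible : ∀ {L L′ 𝒞} → SimilarityModels ⊆ 𝒞 → ELM ⊑ L → L′ ⊑ ELCD →
    ¬ (L ≼[ 𝒞 ] L′)
  M-inexpressible sim⊆𝒞 ELM⊑L L′⊑ELCD =
    inexpressible (M[ everybody ] var 0) sim⊆𝒞 (ELM⊑L _ (M tt everybody (var 0)))
      λ ψ ψ∈L′ →
        -- With no labels on the loop, a relation is empty as soon as its label set is inhabited.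
        -- The shared capability has a common label, whereas the two colours have none.
        point (λ _ → U) ∅ , tt , point colourCap ∅ , tt
      , point-similarity {A = ⊤} (λ _ → U) ∅ , point-similarity colourCap ∅
      , (λ t r → r (λ _ → tt))
      , (λ h → h tt λ x → case trans (sym (x (zero , ∈⊤))) (x (suc zero , ∈⊤)) of λ ())
      , reflects-transfer
          (point-value (λ _ → U) (λ _ → tt , tt) (L′⊑ELCD ψ ψ∈L′))
          (point-value colourCap (λ a → colour a , refl) (L′⊑ELCD ψ ψ∈L′))
    where
    point-value : ∀ {A : Set} (cap : Agent → Pred A 0ℓ) → (∀ a → ∃ (cap a)) →
      ∀ {φ} → φ FormulaOf ELCD →
      Reflects (point cap ∅ ⟨ tt ⟩⊨ φ) (value (const true) φ)
    point-value cap inhabited φ∈ELCD =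
      reflects-value (const true) (λ _ → refl) (point cap ∅)
        (λ a → box-empty λ _ _ r → r (proj₂ (inhabited a))) (λ _ _ ())
        (λ _ G → let a , a∈G = Group.nonempty G in
          box-empty λ _ _ r → r ((a , a∈G) , proj₂ (inhabited a)))
        (λ ()) φ∈ELCD tt

lemma12 : (n : ℕ) → 2 ≤ n → let open Logic n in
    (∀ L L′ → ELC ⊑ L → L′ ⊑ ELDM →
    ¬ (L ≼[ AllModels ] L′) × ¬ (L ≼[ SimilarityModels ] L′))
    × (∀ L L′ → ELD ⊑ L → L′ ⊑ ELCM →
    ¬ (L ≼[ AllModels ] L′) × ¬ (L ≼[ SimilarityModels ] L′))
    × (∀ L L′ → ELM ⊑ L → L′ ⊑ ELCD →
    ¬ (L ≼[ AllModels ] L′) × ¬ (L ≼[ SimilarityModels ] L′))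
lemma12 (suc (suc m)) (s≤s (s≤s z≤n)) =
    -- The first argument embeds the similarity models into all models, then into themselves.
    (λ L L′ p q → C-inexpressible _ p q , C-inexpressible id p q)
  , (λ L L′ p q → D-inexpressible _ p q , D-inexpressible id p q)
  , (λ L L′ p q → M-inexpressible _ p q , M-inexpressible id p q)
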